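{- For every cactus graph $G\in\mathcal{C}_{n,k}$ it holds that $\mathrm{gpn}(G)\geq\binom{n+1}{2}$, with equality if and only if each cycle in $G$ is of odd length.
   Context: All graphs are finite, simple and connected. For distinct $u,v\in V(G)$, $\mathrm{gpn}_G(u,v)$ denotes the number of shortest $u$–$v$ paths in $G$, and for a graph $G$ on $n$ vertices $\mathrm{gpn}(G)=\sum_{\{u,v\}\subseteq V(G),\,u\neq v}\mathrm{gpn}_G(u,v)+n$ (sum over unordered pairs of distinct vertices). A cactus graph is a (connected, simple) graph in which all cycles are pairwise edge disjoint. $\mathcal{C}_{n,k}$ is the class of all cactus graphs on $n$ vertices with exactly $k$ cycles. -}

module Defs where

open import Data.Fin using (Fin; zero; suc)
open import Data.Fin.Properties using (_≟_; _<?_; injective⇒≤)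
open import Data.List
  using (List; []; _∷_; _∷ʳ_; allFin; cartesianProduct; cartesianProductWith;
         concatMap; filter; head; last; length; lookup; map; upTo; zip)
open import Data.List.Membership.Propositional using (_∈_; lose)
open import Data.List.Membership.Propositional.Properties
  using (∈-allFin; ∈-cartesianProductWith⁺; ∈-concatMap⁺; ∈-upTo⁺; ∈-filter⁺; ∈-filter⁻;
         ∈-lookup)
open import Data.List.Relation.Unary.All as All using (All)
open import Data.List.Relation.Unary.AllPairs using (AllPairs; _∷_)
open import Data.List.Relation.Unary.Any using (Any; here)
open import Data.List.Relation.Unary.Linked as Linked using (Linked)
open import Data.List.Relation.Unary.Unique.Propositional using (Unique)
import Data.List.Relation.Unary.Unique.DecPropositional as DecUnique
open import Data.Maybe using (just)
open import Data.Maybe.Properties using (≡-dec)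
open import Data.Nat using (ℕ; zero; suc; _+_; _≤_; _≤?_; s≤s; NonZero)
open import Data.Nat.ListAction using (sum)
open import Data.Product using (_×_; _,_; proj₂; uncurry; ∃-syntax)
open import Data.Sum using (_⊎_)
open import Function using (_⇔_; Injective)
open import Relation.Binary using (Rel; Decidable; Symmetric; Irreflexive)
open import Relation.Binary.PropositionalEquality using (_≡_; refl; sym; cong)
open import Relation.Nullary using (¬_; Dec; contradiction)
open import Relation.Nullary.Decidable using (_×-dec_; map′)
open import Level using (0ℓ)

-- Adjacency is required to be decidable, as it always is classically,
-- so that paths can be counted.
record Graph (n : ℕ) : Set₁ where
  infix 4 _~_ _~?_
  field
    _~_     : Rel (Fin n) 0ℓ
    _~?_    : Decidable _~_
    ~-sym   : Symmetric _~_
    ~-irrefl : Irreflexive _≡_ _~_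

sequences : (n m : ℕ) → List (List (Fin n))
sequences n zero    = [] ∷ []
sequences n (suc m) = cartesianProductWith _∷_ (allFin n) (sequences n m)

-- Without repetition: each list of length at most n occurs exactly once.
boundedSequences : (n : ℕ) → List (List (Fin n))
boundedSequences n = concatMap (sequences n) (upTo (suc n))

∈-sequences : ∀ {n} (p : List (Fin n)) → p ∈ sequences n (length p)
∈-sequences []      = here refl
∈-sequences (x ∷ p) = ∈-cartesianProductWith⁺ _∷_ (∈-allFin x) (∈-sequences p)

lookup-injective : ∀ {A : Set} {xs : List A} → Unique xs → Injective _≡_ _≡_ (lookup xs)
lookup-injective (_ ∷ _)    {zero}  {zero}  _  = refl
lookup-injective (x∉ ∷ _)   {zero}  {suc j} eq = contradiction eq (All.lookup x∉ (∈-lookup j))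
lookup-injective (x∉ ∷ _)   {suc i} {zero}  eq = contradiction (sym eq) (All.lookup x∉ (∈-lookup i))
lookup-injective (_ ∷ uniq) {suc i} {suc j} eq = cong suc (lookup-injective uniq eq)

∈-boundedSequences : ∀ {n} {p : List (Fin n)} → Unique p → p ∈ boundedSequences n
∈-boundedSequences {n} {p} uniq =
  ∈-concatMap⁺ (sequences n) (lose (∈-upTo⁺ (s≤s length≤n)) (∈-sequences p))
  where
  length≤n : length p ≤ n
  length≤n = injective⇒≤ (lookup-injective uniq)

module _ {n : ℕ} (G : Graph n) where
  open Graph G

  IsPath : Fin n → Fin n → List (Fin n) → Set
  IsPath u v p = head p ≡ just u × last p ≡ just v × Unique p × Linked _~_ p

  isPath? : ∀ u v p → Dec (IsPath u v p)
  isPath? u v p =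
    ≡-dec _≟_ (head p) (just u) ×-dec ≡-dec _≟_ (last p) (just v) ×-dec
    DecUnique.unique? _≟_ p ×-dec Linked.linked? _~?_ p

  -- Lengths are compared by number of vertices, i.e. number of edges plus one.
  IsShortestPath : Fin n → Fin n → List (Fin n) → Set
  IsShortestPath u v p =
    IsPath u v p × (∀ q → IsPath u v q → length p ≤ length q)

  isShortestPath? : ∀ u v p → Dec (IsShortestPath u v p)
  isShortestPath? u v p = isPath? u v p ×-dec map′ to from
    (All.all? (λ q → length p ≤? length q) (filter (isPath? u v) (boundedSequences n)))
    where
    paths = filter (isPath? u v) (boundedSequences n)
    to : All (λ q → length p ≤ length q) paths → ∀ q → IsPath u v q → length p ≤ length q
    to all q path@(_ , _ , uniq , _) =
      All.lookup all (∈-filter⁺ (isPath? u v) (∈-boundedSequences uniq) path)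
    from : (∀ q → IsPath u v q → length p ≤ length q) → All (λ q → length p ≤ length q) paths
    from min = All.tabulate λ {q} q∈ →
      min q (proj₂ (∈-filter⁻ (isPath? u v) {xs = boundedSequences n} q∈))

  gpnBetween : Fin n → Fin n → ℕ
  gpnBetween u v = length (filter (isShortestPath? u v) (boundedSequences n))

  -- An unordered pair of distinct vertices is represented by (u , v) with u < v.
  vertexPairs : List (Fin n × Fin n)
  vertexPairs = filter (uncurry _<?_) (cartesianProduct (allFin n) (allFin n))

  gpn : ℕ
  gpn = sum (map (uncurry gpnBetween) vertexPairs) + n

  Connected : Set
  Connected = NonZero n × (∀ u v → ∃[ p ] IsPath u v p)

-- For c = v₁ , … , vₗ these are (v₁ , v₂) , … , (vₗ₋₁ , vₗ) , (vₗ , v₁).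
cyclicSteps : {A : Set} → List A → List (A × A)
cyclicSteps []       = []
cyclicSteps (v ∷ vs) = zip (v ∷ vs) (vs ∷ʳ v)

module _ {n : ℕ} where

  EdgeOf : List (Fin n) → Fin n → Fin n → Set
  EdgeOf c x y = (x , y) ∈ cyclicSteps c ⊎ (y , x) ∈ cyclicSteps c

  -- A cycle is a subgraph: vertex lists that differ by rotation or reversal
  -- describe the same cycle.
  SameCycle : List (Fin n) → List (Fin n) → Set
  SameCycle c d = ∀ x y → EdgeOf c x y ⇔ EdgeOf d x y

  EdgeDisjoint : List (Fin n) → List (Fin n) → Set
  EdgeDisjoint c d = ∀ x y → ¬ (EdgeOf c x y × EdgeOf d x y)

module _ {n : ℕ} (G : Graph n) where
  open Graph G

  -- The length of the list is the length of the cycle.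
  IsCycle : List (Fin n) → Set
  IsCycle c = 3 ≤ length c × Unique c × All (uncurry _~_) (cyclicSteps c)

  IsCactus : Set
  IsCactus = Connected G ×
    (∀ c d → IsCycle c → IsCycle d → ¬ SameCycle c d → EdgeDisjoint c d)

  HasExactlyCycles : ℕ → Set
  HasExactlyCycles k = ∃[ cs ]
    length cs ≡ k × All IsCycle cs × AllPairs (λ c d → ¬ SameCycle c d) cs ×
    (∀ c → IsCycle c → Any (SameCycle c) cs)

-- 𝒞ₙ,ₖ, for graphs with vertex set Fin n.
_∈𝒞_ : ∀ {n} → Graph n → ℕ → Set
G ∈𝒞 k = IsCactus G × HasExactlyCycles G k

{-# OPTIONS --safe #-}
-- The bound holds because every pair of vertices is joined by at least one
-- shortest path; equality means that all shortest paths are unique.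
--
-- Fix a root u and call the distance of a vertex to u its level.  Two vertices
-- of equal level can be joined through lower levels: descend from both along
-- shortest paths until the two descents meet.  This arc has an even number of
-- edges.  If two shortest paths to u differ, some vertex has two lower
-- neighbours, and with the arc between them it lies on an even cycle.
--
-- Conversely let shortest paths be unique, and let u lie on a cycle c.  An edge
-- of c within one level closes the arc between its ends to a cycle all of whose
-- other edges change level, so in a cactus c has at most one such edge.  No
-- vertex has two lower neighbours, hence along c the level first rises, stays
-- constant over one edge, and then falls back to 0: c is odd.
module Submission where

open import Defs
open import Data.Empty using (⊥)
open import Data.Fin using (Fin; zero; suc)
import Data.Fin as Fin
open import Data.Fin.Properties using (_≟_; _<?_; <-cmp)
open import Data.List
  using (List; []; _∷_; _∷ʳ_; _++_; [_]; allFin; cartesianProduct; filter; length;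
         map; reverse; upTo; zip)
import Data.Nat.Properties as ℕ
open import Data.List.Extrema ℕ.≤-totalOrder
  using (argmin; argmin-all; f[argmin]≤f[xs])
open import Data.List.Membership.Propositional using (_∈_; _∉_)
open import Data.List.Membership.Propositional.Properties
  using (∈-allFin; ∈-cartesianProduct⁺; ∈-cartesianProductWith⁻; ∈-filter⁺; ∈-filter⁻; ∈-++⁺ʳ; ∈-++⁻; ∈-length)
import Data.List.Membership.DecPropositional as DecMembership
open import Data.List.Properties
  using (length-++; length-map; length-tabulate; map-tabulate; map-∘; map-cong; filter-++; filter-≐; filter-all;
         ∷-injective; reverse-injective; unfold-reverse; length-reverse)
open import Data.List.Relation.Unary.All as All using (All; []; _∷_)
open import Data.List.Relation.Unary.All.Properties
  using (¬Any⇒All¬; All¬⇒¬Any; ∷ʳ⁺; map⁺)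
open import Data.List.Relation.Unary.AllPairs as AllPairs using ([]; _∷_)
import Data.List.Relation.Unary.AllPairs.Properties as AllPairs
open import Data.List.Relation.Unary.Any using (here; there)
import Data.List.Relation.Unary.Any.Properties as Any
open import Data.List.Relation.Unary.Linked using ([-]; _∷_)
open import Data.List.Relation.Unary.Unique.Propositional using (Unique)
import Data.List.Relation.Unary.Unique.Propositional.Properties as Unique
open import Data.Nat
  using (ℕ; zero; suc; pred; _+_; _*_; _≤_; _<_; _≥_; z≤n; s≤s; s≤s⁻¹; z<s; s<s)
open import Data.Nat.Combinatorics using (_C_; nC1≡n; nCk+nC[k+1]≡[n+1]C[k+1])
open import Data.Nat.Divisibility using (_∣_; ∣m∣n⇒∣m+n; ∣m+n∣m⇒∣n; ∣⇒≤; ∣-refl; divides)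
open import Data.Nat.ListAction using (sum)
open import Data.Nat.Properties hiding (_≟_; _<?_; <-cmp)
open import Data.Product using (_×_; _,_; proj₁; proj₂; swap; uncurry; ∃-syntax)
open import Data.Product.Properties using (≡-dec)
open import Data.Sum using (_⊎_; inj₁; inj₂; [_,_]′)
open import Function using (_⇔_; mk⇔; Equivalence; _∘_; id)
open import Relation.Binary using (tri<; tri≈; tri>)
open import Relation.Binary.PropositionalEquality
  using (_≡_; _≢_; refl; sym; trans; cong; cong₂; subst; module ≡-Reasoning)
open import Relation.Nullary using (¬_; yes; no; contradiction)
open import Relation.Nullary.Decidable using (_⊎-dec_; decidable-stable)
open import Relation.Unary using (Decidable)

-- Steps of a walk given by its list of vertices.

module _ {A : Set} where

  -- cyclicSteps (v ∷ vs) is steps v vs v.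
  steps : A → List A → A → List (A × A)
  steps x ws z = zip (x ∷ ws) (ws ∷ʳ z)

  steps-∷ʳ : ∀ x ws y z → steps x (ws ∷ʳ y) z ≡ steps x ws y ∷ʳ (y , z)
  steps-∷ʳ x []       y z = refl
  steps-∷ʳ x (w ∷ ws) y z = cong ((x , w) ∷_) (steps-∷ʳ w ws y z)

  All-steps-∷ʳ⁺ : ∀ {P : A × A → Set} x ws {y z} →
    All P (steps x ws y) → P (y , z) → All P (steps x (ws ∷ʳ y) z)
  All-steps-∷ʳ⁺ x ws {y} {z} ps p = subst (All _) (sym (steps-∷ʳ x ws y z)) (∷ʳ⁺ ps p)

  ∈-zip⁻ : ∀ {a b : A} xs ys → (a , b) ∈ zip xs ys → a ∈ xs × b ∈ ys
  ∈-zip⁻ (x ∷ xs) (y ∷ ys) (here refl) = here refl , here refl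
  ∈-zip⁻ (x ∷ xs) (y ∷ ys) (there ab∈) =
    let a∈ , b∈ = ∈-zip⁻ xs ys ab∈ in there a∈ , there b∈

  length-∷ʳ : ∀ (xs : List A) x → length (xs ∷ʳ x) ≡ suc (length xs)
  length-∷ʳ xs x = trans (length-++ xs) (+-comm _ 1)

  Unique-∷ʳ⁺ : ∀ {xs : List A} {x} → Unique xs → All (_≢ x) xs → Unique (xs ∷ʳ x)
  Unique-∷ʳ⁺ uniq xs≢x = AllPairs.++⁺ uniq ([] ∷ []) (All.map (_∷ []) xs≢x)

  -- The no-backtracking condition on a walk: `x` is the vertex before the current one, and `ws`
  -- followed by `z` are the vertices after it.
  ≢next : List A → A → A → Set
  ≢next []      z x = x ≢ z
  ≢next (w ∷ _) z x = x ≢ w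

  All≢⇒≢next : ∀ {x z : A} {ws} → All (x ≢_) ws → x ≢ z → ≢next ws z x
  All≢⇒≢next []        x≢z = x≢z
  All≢⇒≢next (x≢w ∷ _) x≢z = x≢w

-- Sums of positive terms, and lists with at most one element.

module _ {A : Set} {f : A → ℕ} where

  length≤sum : ∀ {xs} → All (λ x → 1 ≤ f x) xs → length xs ≤ sum (map f xs)
  length≤sum []         = z≤n
  length≤sum (1≤ ∷ 1≤s) = +-mono-≤ 1≤ (length≤sum 1≤s)

  -- The remaining terms already contribute at least their number, so the first one cannot exceed 1.
  sum≡length⁻ : ∀ {xs} → All (λ x → 1 ≤ f x) xs → sum (map f xs) ≡ length xs →
                All (λ x → f x ≡ 1) xs
  sum≡length⁻ []                   eq = []
  sum≡length⁻ {x ∷ xs} (1≤ ∷ 1≤s) eq = fx≡1 ∷ sum≡length⁻ 1≤s sum≡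
    where
    fx≡1 : f x ≡ 1
    fx≡1 = ≤-antisym
      (+-cancelʳ-≤ (length xs) (f x) 1
        (≤-trans (+-monoʳ-≤ (f x) (length≤sum 1≤s)) (≤-reflexive eq)))
      1≤
    sum≡ : sum (map f xs) ≡ length xs
    sum≡ = suc-injective (trans (cong (_+ sum (map f xs)) (sym fx≡1)) eq)

  sum≡length⁺ : ∀ {xs} → All (λ x → f x ≡ 1) xs → sum (map f xs) ≡ length xs
  sum≡length⁺ []         = refl
  sum≡length⁺ (f≡ ∷ f≡s) = cong₂ _+_ f≡ (sum≡length⁺ f≡s)

module _ {A : Set} where

  length≡1⇒≡ : ∀ {xs : List A} {x y} → length xs ≡ 1 → x ∈ xs → y ∈ xs → x ≡ y
  length≡1⇒≡ {_ ∷ []} _ (here refl) (here refl) = refl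

  unique⇒length≤1 : ∀ {xs : List A} → Unique xs → (∀ {x y} → x ∈ xs → y ∈ xs → x ≡ y) →
                    length xs ≤ 1
  unique⇒length≤1 {[]}         _                  _   = z≤n
  unique⇒length≤1 {_ ∷ []}     _                  _   = s≤s z≤n
  unique⇒length≤1 {_ ∷ _ ∷ _} ((x≢y ∷ _) ∷ _) all≡ =
    contradiction (all≡ (here refl) (there (here refl))) x≢y

-- Absence of repetitions in the enumeration of vertex lists.

length-sequences : ∀ n m {p} → p ∈ sequences n m → length p ≡ m
length-sequences n zero    (here refl) = refl
length-sequences n (suc m) p∈
  with ∈-cartesianProductWith⁻ _∷_ (allFin n) (sequences n m) p∈
... | _ , _ , _ , q∈ , refl = cong suc (length-sequences n m q∈)

sequences-unique : ∀ n m → Unique (sequences n m)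
sequences-unique n zero    = [] ∷ []
sequences-unique n (suc m) =
  Unique.cartesianProductWith⁺ _∷_ ∷-injective (Unique.allFin⁺ n) (sequences-unique n m)

-- The blocks for different lengths are disjoint because a list determines its length. Hence
-- filtering counts each path once.
boundedSequences-unique : ∀ n → Unique (boundedSequences n)
boundedSequences-unique n = Unique.concat⁺
  (map⁺ (All.universal (sequences-unique n) (upTo (suc n))))
  (AllPairs.map⁺ (AllPairs.map
    (λ i≢j {_} (p∈i , p∈j) → i≢j (trans (sym (length-sequences n _ p∈i)) (length-sequences n _ p∈j)))
    (Unique.upTo⁺ (suc n))))

-- The number of unordered vertex pairs.

module _ {A B : Set} {P : B → Set} (P? : Decidable P) (f : A → B) where

  length-filter-map : ∀ xs → length (filter P? (map f xs)) ≡ length (filter (P? ∘ f) xs)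
  length-filter-map []       = refl
  length-filter-map (x ∷ xs) with P? (f x)
  ... | yes _ = cong suc (length-filter-map xs)
  ... | no  _ = length-filter-map xs

module _ {A B : Set} {P : A × B → Set} (P? : Decidable P) where

  length-filter-× : ∀ xs ys → length (filter P? (cartesianProduct xs ys)) ≡
                    sum (map (λ x → length (filter (P? ∘ (x ,_)) ys)) xs)
  length-filter-× []       ys = refl
  length-filter-× (x ∷ xs) ys = begin
    length (filter P? (map (x ,_) ys ++ cartesianProduct xs ys))
      ≡⟨ cong length (filter-++ P? (map (x ,_) ys) _) ⟩
    length (filter P? (map (x ,_) ys) ++ filter P? (cartesianProduct xs ys))
      ≡⟨ length-++ (filter P? (map (x ,_) ys)) ⟩
    length (filter P? (map (x ,_) ys)) + length (filter P? (cartesianProduct xs ys))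
      ≡⟨ cong₂ _+_ (length-filter-map P? (x ,_) ys) (length-filter-× xs ys) ⟩
    _ ∎
    where open ≡-Reasoning

allFin-suc : ∀ n → allFin (suc n) ≡ zero ∷ map suc (allFin n)
allFin-suc n = cong (zero ∷_) (sym (map-tabulate id suc))

#above : ∀ n → Fin n → ℕ
#above n u = length (filter (u <?_) (allFin n))

#above-zero : ∀ n → #above (suc n) zero ≡ n
#above-zero n = begin
  #above (suc n) zero                             ≡⟨ cong (length ∘ filter (zero {n} <?_)) (allFin-suc n) ⟩
  length (filter (zero {n} <?_) (map suc (allFin n)))
    ≡⟨ cong length (filter-all (zero {n} <?_) (map⁺ (All.universal (λ _ → z<s) (allFin n)))) ⟩
  length (map (suc {n}) (allFin n))               ≡⟨ length-map suc (allFin n) ⟩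
  length (allFin n)                               ≡⟨ length-tabulate id ⟩
  n                                               ∎
  where open ≡-Reasoning

#above-suc : ∀ n u → #above (suc n) (suc u) ≡ #above n u
#above-suc n u = begin
  #above (suc n) (suc u)                       ≡⟨ cong (length ∘ filter (suc u <?_)) (allFin-suc n) ⟩
  length (filter (suc u <?_) (map suc (allFin n)))  ≡⟨ length-filter-map (suc u <?_) suc (allFin n) ⟩
  length (filter ((suc u <?_) ∘ suc) (allFin n))
    ≡⟨ cong length (filter-≐ ((suc u <?_) ∘ suc) (u <?_) (s≤s⁻¹ , s<s) (allFin n)) ⟩
  #above n u                                   ∎
  where open ≡-Reasoning

-- The new vertex `zero` brings `n` pairs and raises the last summand by 1. Together with the old
-- `n + 1 C 2` this is Pascal's rule, as `suc n` is `(n + 1) C 1`.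
sum-#above : ∀ n → sum (map (#above n) (allFin n)) + n ≡ (n + 1) C 2
sum-#above zero    = refl
sum-#above (suc n) = begin
  sum (map (#above (suc n)) (allFin (suc n))) + suc n
    ≡⟨ cong (λ xs → sum (map (#above (suc n)) xs) + suc n) (allFin-suc n) ⟩
  #above (suc n) zero + sum (map (#above (suc n)) (map suc (allFin n))) + suc n
    ≡⟨ cong₂ (λ a b → a + sum b + suc n) (#above-zero n)
         (trans (sym (map-∘ (allFin n))) (map-cong (#above-suc n) (allFin n))) ⟩
  n + S + suc n              ≡⟨ cong (_+ suc n) (+-comm n S) ⟩
  S + n + suc n              ≡⟨ cong (_+ suc n) (sum-#above n) ⟩
  (n + 1) C 2 + suc n        ≡⟨ +-comm _ (suc n) ⟩
  suc n + (n + 1) C 2        ≡⟨ cong (_+ (n + 1) C 2) (trans (+-comm 1 n) (sym (nC1≡n (n + 1)))) ⟩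
  (n + 1) C 1 + (n + 1) C 2  ≡⟨ nCk+nC[k+1]≡[n+1]C[k+1] (n + 1) 1 ⟩
  (suc n + 1) C 2            ∎
  where
  open ≡-Reasoning
  S = sum (map (#above n) (allFin n))

length-vertexPairs : ∀ {n} (G : Graph n) → length (vertexPairs G) + n ≡ (n + 1) C 2
length-vertexPairs {n} G =
  trans (cong (_+ n) (length-filter-× (uncurry _<?_) (allFin n) (allFin n))) (sum-#above n)

-- Paths and shortest paths.

module _ {n : ℕ} (G : Graph n) where
  open Graph G
  open DecMembership (_≟_ {n}) using (_∈?_)

  HasUniqueShortestPaths : Fin n → Set
  HasUniqueShortestPaths u =
    ∀ {x p q} → IsShortestPath G x u p → IsShortestPath G x u q → p ≡ q

  isPath-[-] : ∀ u → IsPath G u u [ u ]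
  isPath-[-] u = refl , refl , [] ∷ [] , [-]

  isPath-∷ : ∀ {x y v p} → x ~ y → x ∉ p → IsPath G y v p → IsPath G x v (x ∷ p)
  isPath-∷ {p = _ ∷ _} x~y x∉p (refl , last≡ , uniq , linked) =
    refl , last≡ , ¬Any⇒All¬ _ x∉p ∷ uniq , x~y ∷ linked

  isPath-tail : ∀ {x v y p} → IsPath G x v (x ∷ y ∷ p) → IsPath G y v (y ∷ p)
  isPath-tail (_ , last≡ , _ ∷ uniq , _ ∷ linked) = refl , last≡ , uniq , linked

  isPath-∷ʳ : ∀ {u v w} p → IsPath G u v p → v ~ w → w ∉ p → IsPath G u w (p ∷ʳ w)
  isPath-∷ʳ (x ∷ []) (refl , refl , _) v~w w∉p =
    isPath-∷ v~w (λ { (here refl) → w∉p (here refl) }) (isPath-[-] _)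
  isPath-∷ʳ (x ∷ y ∷ p) path@(refl , _ , x∉ ∷ _ , x~y ∷ _) v~w w∉p =
    isPath-∷ x~y
      (λ x∈ → [ All¬⇒¬Any x∉ , (λ { (here refl) → w∉p (here refl) }) ]′ (∈-++⁻ (y ∷ p) x∈))
      (isPath-∷ʳ (y ∷ p) (isPath-tail path) v~w (w∉p ∘ there))

  isPath-reverse : ∀ {u v} p → IsPath G u v p → IsPath G v u (reverse p)
  isPath-reverse (x ∷ [])    (refl , refl , _) = isPath-[-] _
  isPath-reverse {u} {v} (x ∷ y ∷ p) path@(refl , _ , x∉ ∷ _ , x~y ∷ _) =
    subst (IsPath G v x) (sym (unfold-reverse x (y ∷ p)))
      (isPath-∷ʳ (reverse (y ∷ p)) (isPath-reverse (y ∷ p) (isPath-tail path)) (~-sym x~y)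
        (All¬⇒¬Any x∉ ∘ Any.reverse⁻))

  isShortestPath-reverse : ∀ {u v p} → IsShortestPath G u v p → IsShortestPath G v u (reverse p)
  isShortestPath-reverse {p = p} (path , min) = isPath-reverse p path , λ q path′ →
    subst (_≤ length q) (sym (length-reverse p))
      (subst (length p ≤_) (length-reverse q) (min (reverse q) (isPath-reverse q path′)))

  isPath-from : ∀ {x u v p} → x ∈ p → IsPath G u v p → ∃[ q ] IsPath G x v q × length q ≤ length p
  isPath-from (here refl) path@(refl , _) = _ , path , ≤-refl
  isPath-from {p = _ ∷ _ ∷ _} (there x∈) path@(refl , _) =
    let q , path′ , q≤ = isPath-from x∈ (isPath-tail path) in q , path′ , m≤n⇒m≤1+n q≤

  -- If `x` already lies on `p`, the suffix of `p` from `x` serves instead; hence only an upper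
  -- bound on the length.
  isPath-extend : ∀ {x y v p} → x ~ y → IsPath G y v p → ∃[ q ] IsPath G x v q × length q ≤ suc (length p)
  isPath-extend {x} {p = p} x~y path with x ∈? p
  ... | no x∉p  = x ∷ p , isPath-∷ x~y x∉p path , ≤-refl
  ... | yes x∈p = let q , path′ , q≤ = isPath-from x∈p path in q , path′ , m≤n⇒m≤1+n q≤

  -- By `isPath-extend`, a shorter path from `y` would yield a shorter path from `x`.
  isShortestPath-tail : ∀ {x v y p} →
    IsShortestPath G x v (x ∷ y ∷ p) → IsShortestPath G y v (y ∷ p)
  isShortestPath-tail (path@(_ , _ , _ , x~y ∷ _) , min) = isPath-tail path , λ q path′ →
    let r , path″ , r≤ = isPath-extend x~y path′ in s≤s⁻¹ (≤-trans (min r path″) r≤)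

  abstract
    shortestPath : ∀ {u v} → ∃[ p ] IsPath G u v p → ∃[ p ] IsShortestPath G u v p
    -- The given path `p` is the default value of `argmin`, so the result is a path in any case.
    shortestPath {u} {v} (p , path) = argmin length p paths ,
      argmin-all length path (All.tabulate (proj₂ ∘ ∈-filter⁻ (isPath? G u v) {xs = boundedSequences n})) ,
      λ q path′@(_ , _ , uniq , _) →
        All.lookup (f[argmin]≤f[xs] p paths)
          (∈-filter⁺ (isPath? G u v) (∈-boundedSequences uniq) path′)
      where
      paths : List (List (Fin n))
      paths = filter (isPath? G u v) (boundedSequences n)

  -- Levels, and arcs through lower levels.

  module Levels (connected : ∀ u v → ∃[ p ] IsPath G u v p) (u : Fin n) where

    geodesic : ∀ x → ∃[ p ] IsShortestPath G x u p
    geodesic x = shortestPath (connected x u)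

    -- Path lists count vertices, one more than edges; `pred` makes this the distance to `u`.
    level : Fin n → ℕ
    level x = pred (length (proj₁ (geodesic x)))

    suc-level : ∀ x → suc (level x) ≡ length (proj₁ (geodesic x))
    suc-level x with geodesic x
    ... | _ ∷ _ , _ = refl

    level< : ∀ {x p} → IsPath G x u p → level x < length p
    level< {x} {p} path =
      subst (_≤ length p) (sym (suc-level x)) (proj₂ (proj₂ (geodesic x)) p path)

    length≡suc-level : ∀ {x p} → IsShortestPath G x u p → length p ≡ suc (level x)
    length≡suc-level {x} {p} (path , min) = ≤-antisym
      (subst (length p ≤_) (sym (suc-level x)) (min _ (proj₁ (proj₂ (geodesic x)))))
      (level< path)

    level-root : level u ≡ 0
    level-root = n≤0⇒n≡0 (s≤s⁻¹ (level< (isPath-[-] u)))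

    -- Undirected, so that the descent from one end of an arc and the ascent to the other satisfy
    -- the same predicate.
    Vertical : Fin n × Fin n → Set
    Vertical (x , y) = x ~ y × level x ≢ level y

    ~⇒vertical : ∀ {x y} → x ~ y → level x ≡ suc (level y) → Vertical (x , y)
    ~⇒vertical x~y eq = x~y , λ eq′ → 1+n≢n (trans (sym eq) eq′)

    -- The second vertex of the chosen geodesic works, because the tail of a shortest path is
    -- shortest.
    parent : ∀ {x k} → level x ≡ suc k → ∃[ y ] Vertical (x , y) × level y ≡ k
    parent {x} {k} eq = second (proj₂ (geodesic x)) (trans (sym (suc-level x)) (cong suc eq))
      where
      second : ∀ {p} → IsShortestPath G x u p → length p ≡ suc (suc k) → ∃[ y ] Vertical (x , y) × level y ≡ k
      second {_ ∷ y ∷ _} short@((refl , _ , _ , x~y ∷ _) , _) length≡ =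
        y , ~⇒vertical x~y (trans eq (cong suc (sym y≡k))) , y≡k
        where
        y≡k : level y ≡ k
        y≡k = suc-injective
          (trans (sym (length≡suc-level (isShortestPath-tail short))) (suc-injective length≡))

    level≡0⇒root : ∀ {x} → level x ≡ 0 → x ≡ u
    level≡0⇒root {x} eq with geodesic x
    ... | x ∷ [] , (refl , refl , _) , _ = refl

    level≤suc : ∀ {x y} → x ~ y → level x ≤ suc (level y)
    level≤suc {x} {y} x~y =
      let q , path , q≤ = isPath-extend x~y (proj₁ (proj₂ (geodesic y)))
      in s≤s⁻¹ (≤-trans (level< path) (≤-trans q≤ (s≤s (≤-reflexive (sym (suc-level y))))))

    level-~ : ∀ {x y} → x ~ y →
      level x ≡ level y ⊎ level y ≡ suc (level x) ⊎ level x ≡ suc (level y)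
    level-~ {x} {y} x~y with ℕ.<-cmp (level x) (level y)
    ... | tri< x<y _ _ = inj₂ (inj₁ (≤-antisym (level≤suc (~-sym x~y)) x<y))
    ... | tri≈ _ x≡y _ = inj₁ x≡y
    ... | tri> _ _ y<x = inj₂ (inj₂ (≤-antisym (level≤suc x~y) y<x))

    vertical-sym : ∀ {x y} → Vertical (x , y) → Vertical (y , x)
    vertical-sym (x~y , ≢) = ~-sym x~y , ≢ ∘ sym

    parentLevel : ∀ {x y p} → IsShortestPath G x u (x ∷ y ∷ p) → level x ≡ suc (level y)
    parentLevel sp = suc-injective
      (trans (sym (length≡suc-level sp)) (cong suc (length≡suc-level (isShortestPath-tail sp))))

    -- `mid` lists the interior vertices only, and `odd` refers to their number. The arc itself has
    -- `suc (length mid)` edges, an even number.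
    record IsArcBelow (k : ℕ) (x y : Fin n) (mid : List (Fin n)) : Set where
      field
        below    : All (λ z → level z < k) mid
        unique   : Unique mid
        vertical : All Vertical (steps x mid y)
        0<length : 1 ≤ length mid
        odd      : 2 ∣ suc (length mid)

      uniqueWithEnds : level x ≡ k → level y ≡ k → x ≢ y → Unique (x ∷ mid ∷ʳ y)
      uniqueWithEnds x≡k y≡k x≢y =
        ∷ʳ⁺ (All.map (λ z<k x≡z → <⇒≢ z<k (trans (cong level (sym x≡z)) x≡k)) below) x≢y
        ∷ Unique-∷ʳ⁺ unique (All.map (λ z<k z≡y → <⇒≢ z<k (trans (cong level z≡y) y≡k)) below)

    -- Induction on `k`, replacing both ends by parents. Equal parents give an arc of two edges;
    -- otherwise the arc between the parents is prolonged by one edge at each end. On level 0 both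
    -- ends would be the root.
    arcBelow : ∀ k {x y} → level x ≡ k → level y ≡ k → x ≢ y → ∃[ mid ] IsArcBelow k x y mid
    arcBelow zero x≡ y≡ x≢y =
      contradiction (trans (level≡0⇒root x≡) (sym (level≡0⇒root y≡))) x≢y
    arcBelow (suc k) {x} {y} x≡ y≡ x≢y with parent x≡ | parent y≡
    ... | x′ , x-x′ , x′≡ | y′ , y-y′ , y′≡ with x′ ≟ y′
    ...   | yes refl = [ x′ ] , record
      { below    = s≤s (≤-reflexive x′≡) ∷ []
      ; unique   = [] ∷ []
      ; vertical = x-x′ ∷ vertical-sym y-y′ ∷ []
      ; 0<length = s≤s z≤n
      ; odd      = ∣-refl
      }
    ...   | no x′≢y′ =
      let mid , arc = arcBelow k x′≡ y′≡ x′≢y′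
          open IsArcBelow arc
      in x′ ∷ mid ∷ʳ y′ , record
      { below    = s≤s (≤-reflexive x′≡) ∷ ∷ʳ⁺ (All.map m<n⇒m<1+n below) (s≤s (≤-reflexive y′≡))
      ; unique   = uniqueWithEnds x′≡ y′≡ x′≢y′
      ; vertical = x-x′ ∷ All-steps-∷ʳ⁺ x′ mid vertical (vertical-sym y-y′)
      ; 0<length = s≤s z≤n
      ; odd      = subst (λ l → 2 ∣ suc (suc l)) (sym (length-∷ʳ mid y′)) (∣m∣n⇒∣m+n ∣-refl odd)
      }

    -- The edge closes an arc whose interior lies strictly below both ends. The closing step is the
    -- only one of the cycle that is not vertical.
    flatCycle : ∀ {x y mid} → level x ≡ level y → x ~ y → IsArcBelow (level y) x y mid →
                IsCycle G (x ∷ mid ∷ʳ y)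
    flatCycle {x} {y} {mid} x≡y x~y arc =
      s≤s (subst (2 ≤_) (sym (length-∷ʳ mid y)) (s≤s 0<length)) ,
      uniqueWithEnds x≡y refl (λ eq → ~-irrefl eq x~y) ,
      All-steps-∷ʳ⁺ x mid (All.map proj₁ vertical) (~-sym x~y)
      where open IsArcBelow arc

    -- `z` lies above the whole arc from `x` to `y`, so closing the arc through `z` repeats no
    -- vertex and adds two edges to an even number.
    evenCycle : ∀ {x y z} → z ~ x → z ~ y → level z ≡ suc (level x) → level x ≡ level y → x ≢ y →
                ∃[ c ] IsCycle G c × 2 ∣ length c
    evenCycle {x} {y} {z} z~x z~y z≡ x≡y x≢y =
      z ∷ x ∷ mid ∷ʳ y ,
      (s≤s (s≤s (subst (1 ≤_) (sym (length-∷ʳ mid y)) (s≤s z≤n))) ,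
       (z≢ ≤-refl ∷ ∷ʳ⁺ (All.map (z≢ ∘ <⇒≤) below) (z≢ (≤-reflexive (sym x≡y))))
         ∷ uniqueWithEnds refl (sym x≡y) x≢y ,
       z~x ∷ All-steps-∷ʳ⁺ x mid (All.map proj₁ vertical) (~-sym z~y)) ,
      subst (λ l → 2 ∣ suc (suc l)) (sym (length-∷ʳ mid y)) (∣m∣n⇒∣m+n ∣-refl odd)
      where
      arc = arcBelow (level x) refl (sym x≡y) x≢y
      mid = proj₁ arc
      open IsArcBelow (proj₂ arc)
      z≢ : ∀ {w} → level w ≤ level x → z ≢ w
      z≢ w≤x z≡w = <⇒≢ (s≤s w≤x) (trans (cong level (sym z≡w)) z≡)

    -- Two shortest paths are compared from their common start: their next vertices both lie one
    -- level lower, and `evenCycle` applies if these differ.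
    oddCycles⇒unique : (∀ c → IsCycle G c → ¬ (2 ∣ length c)) → HasUniqueShortestPaths u
    oddCycles⇒unique odd sp sq = go refl _ _ sp sq
      where
      -- The start vertices are linked by an equation, since the next two are shown equal only in
      -- the course of the recursion.
      go : ∀ {x y} → x ≡ y → ∀ p q → IsShortestPath G x u p → IsShortestPath G y u q → p ≡ q
      go refl []      _  ((() , _) , _) _
      go refl (_ ∷ _) [] _ ((() , _) , _)
      go refl (_ ∷ []) (_ ∷ []) ((refl , _) , _) ((refl , _) , _) = refl
      -- The level of the start fixes the number of vertices, so neither path can end before the
      -- other.
      go refl (_ ∷ []) (_ ∷ _ ∷ _) sp sq
        with () ← trans (length≡suc-level sp) (sym (length≡suc-level sq))
      go refl (_ ∷ _ ∷ _) (_ ∷ []) sp sq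
        with () ← trans (length≡suc-level sp) (sym (length≡suc-level sq))
      go refl (x ∷ y ∷ p) (_ ∷ z ∷ q)
        sp@((refl , _ , _ , x~y ∷ _) , _) sq@((refl , _ , _ , x~z ∷ _) , _) =
        cong (x ∷_) (go y≡z (y ∷ p) (z ∷ q) (isShortestPath-tail sp) (isShortestPath-tail sq))
        where
        x≡suc-y : level x ≡ suc (level y)
        x≡suc-y = parentLevel sp
        y≡z : y ≡ z
        y≡z = decidable-stable (y ≟ z) λ y≢z →
          let c , cycle , even = evenCycle x~y x~z x≡suc-y
                (suc-injective (trans (sym x≡suc-y) (parentLevel sq))) y≢z
          in odd c cycle even

    -- Cycles through `u` when shortest paths to `u` are unique.

    module _ (uniquePaths : HasUniqueShortestPaths u) where

      geodesic-∷ : ∀ {x z} → z ~ x → level z ≡ suc (level x) →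
                   IsShortestPath G z u (z ∷ proj₁ (geodesic x))
      geodesic-∷ {x} {z} z~x z≡ = isPath-∷ z~x z∉ path , λ q path′ → ≤-trans (≤-reflexive length≡) (level< path′)
        where
        path = proj₁ (proj₂ (geodesic x))
        length≡ : suc (length (proj₁ (geodesic x))) ≡ suc (level z)
        length≡ = cong suc (trans (sym (suc-level x)) (sym z≡))
        -- Otherwise the suffix from `z` would reach `u` with too few vertices for the level of `z`.
        z∉ : z ∉ proj₁ (geodesic x)
        z∉ z∈ = let q , path′ , q≤ = isPath-from z∈ path in
          1+n≰n (≤-trans (≤-reflexive length≡) (≤-trans (level< path′) q≤))

      -- The geodesics of both neighbours, extended by `z`, are shortest paths from `z`. They
      -- coincide, and so do their second vertices.
      parent-unique : ∀ {x y z} → z ~ x → z ~ y → level z ≡ suc (level x) → level z ≡ suc (level y) → x ≡ y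
      parent-unique {x} {y} z~x z~y z≡suc-x z≡suc-y
        with geodesic x | geodesic y | uniquePaths (geodesic-∷ z~x z≡suc-x) (geodesic-∷ z~y z≡suc-y)
      ... | _ ∷ _ , (refl , _) , _ | _ ∷ _ , (refl , _) , _ | refl = refl

      -- Having to return to level 0, the walk would have a peak, with two lower neighbours.
      rising⊥ : ∀ w x ws → x ~ w → level x ≡ suc (level w) → ≢next ws u w →
                Unique (x ∷ ws) → All (_≢ u) (x ∷ ws) → All Vertical (steps x ws u) → ⊥
      rising⊥ w x [] x~w up w≢u _ _ ((x~u , x≢u) ∷ []) with level-~ x~u
      ... | inj₁ flat          = x≢u flat
      ... | inj₂ (inj₁ u≡suc)  with () ← trans (sym level-root) u≡suc
      ... | inj₂ (inj₂ x≡suc)  = w≢u (parent-unique x~w x~u up x≡suc)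
      rising⊥ w x (y ∷ ws) x~w up w≢y ((_ ∷ x≢ws) ∷ uniq) (x≢u ∷ ≢u) ((x~y , x≢y) ∷ verts) with level-~ x~y
      ... | inj₁ flat          = x≢y flat
      ... | inj₂ (inj₁ y≡suc)  = rising⊥ x y ws (~-sym x~y) y≡suc (All≢⇒≢next x≢ws x≢u) uniq ≢u verts
      ... | inj₂ (inj₂ x≡suc)  = w≢y (parent-unique x~w x~y up x≡suc)

      -- `rising⊥` excludes an upward step, so each of the `suc (length ws)` steps to `u` descends
      -- by exactly one level.
      falling : ∀ x ws → Unique (x ∷ ws) → All (_≢ u) (x ∷ ws) → All Vertical (steps x ws u) →
                suc (length ws) ≡ level x
      falling x [] _ (x≢u ∷ _) ((x~u , _) ∷ []) =
        ≤-antisym (n≢0⇒n>0 (x≢u ∘ level≡0⇒root)) (subst (λ l → level x ≤ suc l) level-root (level≤suc x~u))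
      falling x (y ∷ ws) ((_ ∷ x≢ws) ∷ uniq) (x≢u ∷ ≢u) ((x~y , x≢y) ∷ verts) with level-~ x~y
      ... | inj₁ flat          = contradiction flat x≢y
      ... | inj₂ (inj₁ y≡suc)  =
        contradiction verts (rising⊥ x y ws (~-sym x~y) y≡suc (All≢⇒≢next x≢ws x≢u) uniq ≢u)
      ... | inj₂ (inj₂ x≡suc)  = trans (cong suc (falling y ws uniq ≢u verts)) (sym x≡suc)

      -- `E` stands for the steps of the whole cycle and stays fixed while the walk along the cycle
      -- is consumed.
      module _ (E : List (Fin n × Fin n)) (E⊆~ : All (uncurry _~_) E)
               (oneFlat : ∀ {a b a′ b′} → (a , b) ∈ E → level a ≡ level b →
                          (a′ , b′) ∈ E → level a′ ≡ level b′ →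
                          (a′ , b′) ≡ (a , b) ⊎ (a′ , b′) ≡ (b , a)) where

        -- A further flat step would be the first one or its reverse and so contain `x`, which the
        -- walk from `y` to `u` avoids.
        vertical-after-flat : ∀ {x y ws} → (x , y) ∈ E → level x ≡ level y → All (x ≢_) (y ∷ ws) → x ≢ u →
                       All (_∈ E) (steps y ws u) → All Vertical (steps y ws u)
        vertical-after-flat {x} {y} {ws} xy∈ x≡y x≢ x≢u ⊆E = All.tabulate λ {(a , b)} ab∈ →
          let ab∈E = All.lookup ⊆E ab∈
              a∈ , b∈ = ∈-zip⁻ (y ∷ ws) (ws ∷ʳ u) ab∈
          in All.lookup E⊆~ ab∈E , λ a≡b → [ (λ { refl → All.lookup x≢ a∈ refl })
             , (λ { refl → All.lookup (∷ʳ⁺ (All.tail x≢) x≢u) b∈ refl }) ]′ (oneFlat xy∈ x≡y ab∈E a≡b)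

        -- An upward step raises `level x` and shortens `ws` by one each, so the sum is invariant.
        -- At the flat edge `falling` measures the rest, and the sum is twice `level x`. A downward
        -- step would lead back to `w` by `parent-unique`.
        climbing : ∀ w x ws → x ~ w → level x ≡ suc (level w) → ≢next ws u w →
                   Unique (x ∷ ws) → All (_≢ u) (x ∷ ws) → All (_∈ E) (steps x ws u) →
                   2 ∣ level x + length ws
        climbing w x [] x~w up w≢u _ _ (xu∈ ∷ []) with level-~ (All.lookup E⊆~ xu∈)
        ... | inj₁ flat          with () ← trans (sym up) (trans flat level-root)
        ... | inj₂ (inj₁ u≡suc)  with () ← trans (sym level-root) u≡suc
        ... | inj₂ (inj₂ x≡suc)  =
          contradiction (parent-unique x~w (All.lookup E⊆~ xu∈) up x≡suc) w≢u
        climbing w x (y ∷ ws) x~w up w≢y ((x≢y ∷ x≢ws) ∷ uniq) (x≢u ∷ ≢u) (xy∈ ∷ ⊆E)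
          with level-~ (All.lookup E⊆~ xy∈)
        ... | inj₁ flat          = divides (level x) (begin
          level x + suc (length ws)  ≡⟨ cong (level x +_) (falling y ws uniq ≢u
                                          (vertical-after-flat xy∈ flat (x≢y ∷ x≢ws) x≢u ⊆E)) ⟩
          level x + level y          ≡⟨ cong (level x +_) (sym flat) ⟩
          level x + level x          ≡⟨ cong (level x +_) (sym (+-identityʳ (level x))) ⟩
          2 * level x                ≡⟨ *-comm 2 (level x) ⟩
          level x * 2                ∎)
          where open ≡-Reasoning
        ... | inj₂ (inj₁ y≡suc)  =
          subst (2 ∣_) (trans (cong (_+ length ws) y≡suc) (sym (+-suc (level x) (length ws))))
            (climbing x y ws (~-sym (All.lookup E⊆~ xy∈)) y≡suc (All≢⇒≢next x≢ws x≢u) uniq ≢u ⊆E)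
        ... | inj₂ (inj₂ x≡suc)  =
          contradiction (parent-unique x~w (All.lookup E⊆~ xy∈) up x≡suc) w≢y

  -- Flat edges and the parity of cycles in a cactus.

  cactus⇒oneFlat : (cactus : IsCactus G) (u : Fin n) →
    let open Levels (proj₂ (proj₁ cactus)) u in
    ∀ {c a b a′ b′} → IsCycle G c →
    (a , b) ∈ cyclicSteps c → level a ≡ level b → (a′ , b′) ∈ cyclicSteps c → level a′ ≡ level b′ →
    (a′ , b′) ≡ (a , b) ⊎ (a′ , b′) ≡ (b , a)
  cactus⇒oneFlat (conn , disjoint) u {c} {a} {b} {a′} {b′} cyc ab∈ a≡b a′b′∈ a′≡b′ =
    -- If `(a′ , b′)` were a second flat edge, the cycle `d` formed by `(a , b)` and an arc below it
    -- would miss that edge and so differ from `c`, yet both contain `(a , b)`.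
    decidable-stable (((a′ , b′) ≟² (a , b)) ⊎-dec ((a′ , b′) ≟² (b , a))) λ distinct →
      disjoint c d cyc (flatCycle (sym a≡b) (~-sym a~b) arc)
        (λ same → distinct (flatEdge (Equivalence.to (same a′ b′) (inj₁ a′b′∈))))
        a b (inj₁ ab∈ , inj₁ (subst ((a , b) ∈_) (sym d-steps) (∈-++⁺ʳ (steps b mid a) (here refl))))
    where
    open Levels (proj₂ conn) u
    _≟²_ = ≡-dec _≟_ _≟_
    a~b : a ~ b
    a~b = All.lookup (proj₂ (proj₂ cyc)) ab∈
    arc′ = arcBelow (level a) (sym a≡b) refl (λ b≡a → ~-irrefl (sym b≡a) a~b)
    mid = proj₁ arc′
    arc = proj₂ arc′
    open IsArcBelow arc using (vertical)
    -- The arc runs from `b` to `a`, so that the closing step of `d` is `(a , b)`, in the direction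
    -- it has in `c`.
    d = b ∷ mid ∷ʳ a
    d-steps : cyclicSteps d ≡ steps b mid a ∷ʳ (a , b)
    d-steps = steps-∷ʳ b mid a b
    flatStep : ∀ {x y} → level x ≡ level y → (x , y) ∈ cyclicSteps d → (x , y) ≡ (a , b)
    flatStep {x} {y} x≡y xy∈ with ∈-++⁻ (steps b mid a) (subst ((x , y) ∈_) d-steps xy∈)
    ... | inj₁ xy∈′       = contradiction x≡y (proj₂ (All.lookup vertical xy∈′))
    ... | inj₂ (here eq)  = eq
    flatEdge : EdgeOf d a′ b′ → (a′ , b′) ≡ (a , b) ⊎ (a′ , b′) ≡ (b , a)
    flatEdge (inj₁ a′b′∈d) = inj₁ (flatStep a′≡b′ a′b′∈d)
    flatEdge (inj₂ b′a′∈d) = inj₂ (cong swap (flatStep (sym a′≡b′) b′a′∈d))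

  -- With the head of `c` as root, the next vertex has level 1, and `climbing` from there shows that
  -- one less than the length of `c` is even.
  cactus∧unique⇒odd : IsCactus G → (∀ u → HasUniqueShortestPaths u) →
                      ∀ c → IsCycle G c → ¬ (2 ∣ length c)
  cactus∧unique⇒odd _ _ (_ ∷ [])     (s≤s () , _)
  cactus∧unique⇒odd _ _ (_ ∷ _ ∷ []) (s≤s (s≤s ()) , _)
  cactus∧unique⇒odd cactus unique c@(u ∷ v ∷ w ∷ ws)
    cyc@(_ , (u≢v ∷ u≢w ∷ u≢ws) ∷ uniq , u~v ∷ adj) even =
    contradiction (∣⇒≤ (∣m+n∣m⇒∣n (subst (2 ∣_) (+-comm 1 _) even) even-tail)) λ { (s≤s ()) }
    where
    open Levels (proj₂ (proj₁ cactus)) u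
    v≡1 : level v ≡ 1
    v≡1 = ≤-antisym (subst (λ l → level v ≤ suc l) level-root (level≤suc (~-sym u~v)))
                    (n≢0⇒n>0 (u≢v ∘ sym ∘ level≡0⇒root))
    even-tail : 2 ∣ suc (length (w ∷ ws))
    even-tail = subst (λ l → 2 ∣ l + length (w ∷ ws)) v≡1
      (climbing (unique u) (cyclicSteps c) (u~v ∷ adj) (cactus⇒oneFlat cactus u cyc)
        u v (w ∷ ws) (~-sym u~v) (trans v≡1 (cong suc (sym level-root))) u≢w uniq
        (All.map (_∘ sym) (u≢v ∷ u≢w ∷ u≢ws)) (All.tabulate there))

  -- Numbers of shortest paths.

  module _ (connected : ∀ u v → ∃[ p ] IsPath G u v p) where

    0<gpnBetween : ∀ u v → 1 ≤ gpnBetween G u v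
    0<gpnBetween u v = ∈-length (∈-filter⁺ (isShortestPath? G u v) (∈-boundedSequences uniq) short)
      where
      short = proj₂ (shortestPath (connected u v))
      uniq = proj₁ (proj₂ (proj₂ (proj₁ short)))

    unique⇒gpnBetween≡1 : ∀ {u v} → HasUniqueShortestPaths v → gpnBetween G u v ≡ 1
    unique⇒gpnBetween≡1 {u} {v} unique = ≤-antisym
      (unique⇒length≤1 (Unique.filter⁺ (isShortestPath? G u v) (boundedSequences-unique n))
        (λ p∈ q∈ → unique (short p∈) (short q∈)))
      (0<gpnBetween u v)
      where
      short : ∀ {p} → p ∈ filter (isShortestPath? G u v) (boundedSequences n) → IsShortestPath G u v p
      short = proj₂ ∘ ∈-filter⁻ (isShortestPath? G u v) {xs = boundedSequences n}

  gpnBetween≡1⇒≡ : ∀ {u v p q} → gpnBetween G u v ≡ 1 →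
    IsShortestPath G u v p → IsShortestPath G u v q → p ≡ q
  gpnBetween≡1⇒≡ {u} {v} ≡1 sp sq = length≡1⇒≡ ≡1 (counted sp) (counted sq)
    where
    counted : ∀ {p} → IsShortestPath G u v p → p ∈ filter (isShortestPath? G u v) (boundedSequences n)
    counted sp@((_ , _ , uniq , _) , _) =
      ∈-filter⁺ (isShortestPath? G u v) (∈-boundedSequences uniq) sp

  -- The hypothesis covers one order of each pair; the other follows by reversing paths, and a
  -- shortest path from a vertex to itself is trivial.
  gpnBetween≡1⇒unique : (∀ {u v} → u Fin.< v → gpnBetween G u v ≡ 1) → ∀ u → HasUniqueShortestPaths u
  gpnBetween≡1⇒unique ≡1 u {x} sp sq with <-cmp x u
  ... | tri< x<u _ _    = gpnBetween≡1⇒≡ (≡1 x<u) sp sq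
  ... | tri> _ _ u<x    = reverse-injective
    (gpnBetween≡1⇒≡ (≡1 u<x) (isShortestPath-reverse sp) (isShortestPath-reverse sq))
  ... | tri≈ _ refl _   = trans (trivial _ sp) (sym (trivial _ sq))
    where
    trivial : ∀ p → IsShortestPath G u u p → p ≡ [ u ]
    trivial []          ((() , _) , _)
    trivial (_ ∷ [])    ((refl , _) , _) = refl
    trivial (_ ∷ _ ∷ _) (_ , min) with s≤s () ← min _ (isPath-[-] u)

mainTheorem7 : (n k : ℕ) (G : Graph n) → G ∈𝒞 k →
    gpn G ≥ (n + 1) C 2 ×
    (gpn G ≡ (n + 1) C 2 ⇔ ((c : List (Fin n)) → IsCycle G c → ¬ (2 ∣ length c)))
mainTheorem7 n k G (cactus@((_ , connected) , _) , _) =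
  -- By `#pairs` the binomial coefficient is the number of pairs plus `n`. Both claims thus compare
  -- the count of each pair with 1.
  subst (_≤ gpn G) #pairs (+-monoˡ-≤ n (length≤sum positive)) , mk⇔
    (λ gpn≡ →
      let ones = sum≡length⁻ positive (+-cancelʳ-≡ n _ _ (trans gpn≡ (sym #pairs)))
      in cactus∧unique⇒odd G cactus (gpnBetween≡1⇒unique G λ u<v → All.lookup ones (pair∈ u<v)))
    (λ odd → trans
      (cong (_+ n) (sum≡length⁺ {xs = vertexPairs G} (All.universal
        (λ (u , v) → unique⇒gpnBetween≡1 G connected (Levels.oddCycles⇒unique G connected v odd)) _)))
      #pairs)
  where
  #pairs = length-vertexPairs G
  positive : All (λ p → 1 ≤ uncurry (gpnBetween G) p) (vertexPairs G)
  positive = All.universal (uncurry (0<gpnBetween G connected)) _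
  pair∈ : ∀ {u v} → u Fin.< v → (u , v) ∈ vertexPairs G
  pair∈ = ∈-filter⁺ (uncurry _<?_) (∈-cartesianProduct⁺ (∈-allFin _) (∈-allFin _))
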